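{- For every integer $k\geq 2$ there exists a finite, simple, connected graph of order $\lceil \frac{5k}{2}+1\rceil$ which has metric dimension $k$ and exactly one metric basis.
   Context: For vertices $u,v$ of a connected graph $G$, $d(u,v)$ is the distance between them. For an ordered set $W=\{w_1,\dots,w_k\}\subseteq V(G)$ and $v\in V(G)$, $r(v|W)=(d(v,w_1),\dots,d(v,w_k))$. $W$ is a resolving set if distinct vertices have distinct representations $r(\cdot|W)$. A resolving set of minimum cardinality is a metric basis; its cardinality is the metric dimension $\beta(G)$. -}

module Defs where

open import Data.Nat using (ℕ; zero; suc; _≤_; _<_)
open import Data.Bool using (Bool; true; false)
open import Data.Fin using (Fin)
open import Data.Fin.Subset using (Subset; _∈_; ∣_∣)
open import Data.Product using (Σ; _×_; ∃)
open import Relation.Binary.PropositionalEquality using (_≡_)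
open import Relation.Nullary using (¬_)

record SimpleGraph (n : ℕ) : Set where
  field
    adj     : Fin n → Fin n → Bool
    symm    : ∀ u v → adj u v ≡ adj v u
    loopless : ∀ v → adj v v ≡ false

open SimpleGraph public

module _ {n : ℕ} (G : SimpleGraph n) where

  data Walk : ℕ → Fin n → Fin n → Set where
    here : ∀ {v} → Walk zero v v
    step : ∀ {ℓ u w v} → adj G u w ≡ true → Walk ℓ w v → Walk (suc ℓ) u v

  Connected : Set
  Connected = ∀ u v → ∃ λ ℓ → Walk ℓ u v

  IsDist : Fin n → Fin n → ℕ → Set
  IsDist u v d = Walk d u v × (∀ ℓ → ℓ < d → ¬ Walk ℓ u v)

  SameDist : Fin n → Fin n → Fin n → Set
  SameDist u v w = ∃ λ d → IsDist u w d × IsDist v w d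

  Resolving : Subset n → Set
  Resolving W = ∀ u v → (∀ w → w ∈ W → SameDist u v w) → u ≡ v

  MetricBasis : Subset n → Set
  MetricBasis W = Resolving W × (∀ W′ → Resolving W′ → ∣ W ∣ ≤ ∣ W′ ∣)

  MetricDimension : ℕ → Set
  MetricDimension k = ∃ λ W → MetricBasis W × ∣ W ∣ ≡ k

  UniqueMetricBasis : Set
  UniqueMetricBasis = ∃ λ W → MetricBasis W × (∀ W′ → MetricBasis W′ → W′ ≡ W)

-- Call W locating if vertices outside W with the same neighbours in W are equal.
-- In a graph with a universal vertex all distances are at most 2, so the resolving
-- sets are exactly the locating sets.  Take the join of H with the bull graph: a
-- locating set of the join restricts to locating sets of both sides, and at most
-- one of the two sides has a vertex adjacent to its whole restriction.  If H has a
-- universal vertex and a unique smallest locating set, which misses that vertex,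
-- this forces the bull part to be a locating pair without a common neighbour, and
-- the bull has only one such pair.  So each join adds 5 vertices and 2 basis
-- vertices and preserves the property.  The starting graphs are a single vertex for
-- even k and a graph on 9 vertices for odd k.
module Submission where

open import Defs
open import Data.Nat using (ℕ; zero; suc; z≤n; s≤s; _≤_; _+_; _*_; ⌈_/2⌉; _≡ᵇ_; _≤?_)
open import Data.Nat.Properties
  using (≤-reflexive; ≤-trans; <⇒≤; <-cmp; ≰⇒>; +-cancelˡ-≤; +-cancelʳ-≤; +-monoˡ-≤; *-distribˡ-+)
open import Data.Bool using (Bool; true; false; _∧_; _∨_)
open import Data.Bool.ListAction using (any)
import Data.Bool.Properties as Bool
open import Data.Empty using (⊥-elim)
open import Data.Fin using (Fin; zero; suc; toℕ; splitAt; _↑ˡ_; _↑ʳ_)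
open import Data.Fin.Properties
  using (_≟_; all?; splitAt-↑ˡ; splitAt-↑ʳ; splitAt⁻¹-↑ˡ; splitAt⁻¹-↑ʳ; ↑ˡ-injective; ↑ʳ-injective)
open import Data.Fin.Subset using (Subset; inside; outside; _∈_; _∉_; ∣_∣)
open import Data.Fin.Subset.Properties using (_∈?_; anySubset?)
open import Data.List using (List; []; _∷_)
open import Data.Product using (Σ; _×_; _,_; proj₁)
open import Data.Sum using (_⊎_; inj₁; inj₂)
open import Data.Vec using ([]; _∷_; _++_)
import Data.Vec as Vec
open import Data.Vec.Properties using (≡-dec; lookup-++ˡ; lookup-++ʳ; lookup⇒[]=; []=⇒lookup)
open import Function.Bundles using (mk⇔)
open import Relation.Binary using (tri<; tri≈; tri>)
open import Relation.Binary.PropositionalEquality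
  using (_≡_; _≢_; refl; sym; trans; cong; cong₂; subst)
open import Relation.Nullary using (¬_; Dec; yes; no; contradiction)
open import Relation.Nullary.Decidable
  using (True; toWitness; decidable-stable; map′; ¬?; _→-dec_)
open import Relation.Unary using (Decidable)

private
  variable
    m n k : ℕ

-- Locating sets and universal vertices.

Locating : SimpleGraph n → Subset n → Set
Locating G W = ∀ u v → u ∉ W → v ∉ W → (∀ w → w ∈ W → adj G u w ≡ adj G v w) → u ≡ v

NoCommonNeighbour : SimpleGraph n → Subset n → Set
NoCommonNeighbour G W = ∀ v → ¬ (∀ w → w ∈ W → adj G v w ≡ true)

Universal : SimpleGraph n → Fin n → Set
Universal G h = ∀ v → v ≢ h → adj G h v ≡ true

adj⇒≢ : (G : SimpleGraph n) → ∀ {u v} → adj G u v ≡ true → u ≢ v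
adj⇒≢ G {u} e refl with () ← trans (sym e) (loopless G u)

-- Distances and resolving sets

module _ (G : SimpleGraph n) where

  isDist-unique : ∀ {u v d e} → IsDist G u v d → IsDist G u v e → d ≡ e
  isDist-unique {d = d} {e} (p , p-min) (q , q-min) with <-cmp d e
  ... | tri< d<e _ _ = contradiction p (q-min d d<e)
  ... | tri≈ _ d≡e _ = d≡e
  ... | tri> _ _ e<d = contradiction q (p-min e e<d)

  isDist-self : ∀ {v} → IsDist G v v 0
  isDist-self = here , λ _ ()

  adj⇒isDist : ∀ {u v} → adj G u v ≡ true → IsDist G u v 1
  adj⇒isDist e = step e here , λ where
    zero _ here → adj⇒≢ G e refl
    (suc _) (s≤s ()) _

  sameDist-sym : ∀ {u v w} → SameDist G u v w → SameDist G v u w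
  sameDist-sym (d , p , q) = d , q , p

  sameDist-self : ∀ {u v} → SameDist G u v u → v ≡ u
  sameDist-self (d , p , q , _) with refl ← isDist-unique isDist-self p with here ← q = refl

  sameDist-adj : ∀ {u v w} → SameDist G u v w → adj G u w ≡ true → adj G v w ≡ true
  sameDist-adj (d , p , q , _) e with refl ← isDist-unique (adj⇒isDist e) p with step f here ← q = f

  -- A vertex of `W` is the only one at distance 0 from itself. For two vertices outside `W`,
  -- adjacency is distance 1, so equal distances to `W` give equal neighbours in `W`.
  locating⇒resolving : ∀ {W} → Locating G W → Resolving G W
  locating⇒resolving {W} loc u v same with u ∈? W | v ∈? W
  ... | yes u∈W | _       = sym (sameDist-self (same u u∈W))
  ... | no _    | yes v∈W = sameDist-self (sameDist-sym (same v v∈W))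
  ... | no u∉W  | no v∉W  = loc u v u∉W v∉W λ w w∈W →
    Bool.⇔→≡ (mk⇔ (sameDist-adj (same w w∈W)) (sameDist-adj (sameDist-sym (same w w∈W))))

  module _ {h : Fin n} (universal : Universal G h) where

    toHub : ∀ {v} → v ≢ h → adj G v h ≡ true
    toHub {v} v≢h = trans (symm G v h) (universal v v≢h)

    universal⇒connected : Connected G
    universal⇒connected u v with u ≟ h | v ≟ h
    ... | yes refl | yes refl = 0 , here
    ... | yes refl | no v≢h   = 1 , step (universal v v≢h) here
    ... | no u≢h   | yes refl = 1 , step (toHub u≢h) here
    ... | no u≢h   | no v≢h   = 2 , step (toHub u≢h) (step (universal v v≢h) here)

    ¬adj⇒isDist : ∀ {u v} → u ≢ v → adj G u v ≡ false → IsDist G u v 2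
    ¬adj⇒isDist {u} {v} u≢v e = step (toHub u≢h) (step (universal v v≢h) here) , λ where
        0 _ here → u≢v refl
        1 _ (step f here) → contradiction (trans (sym f) e) λ ()
        (suc (suc _)) (s≤s (s≤s ())) _
      where
      u≢h : u ≢ h
      u≢h refl = contradiction (trans (sym (universal v λ v≡u → u≢v (sym v≡u))) e) λ ()
      v≢h : v ≢ h
      v≢h refl = contradiction (trans (sym (toHub u≢v)) e) λ ()

    -- With a universal vertex, distinct vertices are at distance 1 or 2, so adjacency to a member
    -- of `W` determines the distance to it.
    resolving⇒locating : ∀ {W} → Resolving G W → Locating G W
    resolving⇒locating {W} res u v u∉W v∉W same = res u v λ w w∈W → sameDist w w∈W
      where
      ∉⇒≢ : ∀ {x w} → x ∉ W → w ∈ W → x ≢ w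
      ∉⇒≢ x∉W w∈W refl = x∉W w∈W
      sameDist : ∀ w → w ∈ W → SameDist G u v w
      sameDist w w∈W with adj G u w in eq
      ... | true  = 1 , adj⇒isDist eq , adj⇒isDist (trans (sym (same w w∈W)) eq)
      ... | false = 2 , ¬adj⇒isDist (∉⇒≢ u∉W w∈W) eq
                      , ¬adj⇒isDist (∉⇒≢ v∉W w∈W) (trans (sym (same w w∈W)) eq)

-- Joins

data Side (m n : ℕ) : Fin (m + n) → Set where
  left  : ∀ i → Side m n (i ↑ˡ n)
  right : ∀ j → Side m n (m ↑ʳ j)

side : ∀ m n u → Side m n u
side m n u with splitAt m u in eq
... | inj₁ i = subst (Side m n) (splitAt⁻¹-↑ˡ eq) (left i)
... | inj₂ j = subst (Side m n) (splitAt⁻¹-↑ʳ {m} eq) (right j)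

∈-++⁺ˡ : ∀ {A : Subset m} {B : Subset n} {i} → i ∈ A → i ↑ˡ n ∈ A ++ B
∈-++⁺ˡ {A = A} {B} {i} p = lookup⇒[]= _ (A ++ B) (trans (lookup-++ˡ A B i) ([]=⇒lookup p))

∈-++⁻ˡ : ∀ {A : Subset m} {B : Subset n} {i} → i ↑ˡ n ∈ A ++ B → i ∈ A
∈-++⁻ˡ {A = A} {B} {i} p = lookup⇒[]= i A (trans (sym (lookup-++ˡ A B i)) ([]=⇒lookup p))

∈-++⁺ʳ : ∀ {A : Subset m} {B : Subset n} {j} → j ∈ B → m ↑ʳ j ∈ A ++ B
∈-++⁺ʳ {A = A} {B} {j} p = lookup⇒[]= _ (A ++ B) (trans (lookup-++ʳ A B j) ([]=⇒lookup p))

∈-++⁻ʳ : ∀ {A : Subset m} {B : Subset n} {j} → m ↑ʳ j ∈ A ++ B → j ∈ B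
∈-++⁻ʳ {A = A} {B} {j} p = lookup⇒[]= j B (trans (sym (lookup-++ʳ A B j)) ([]=⇒lookup p))

∣++∣ : (A : Subset m) (B : Subset n) → ∣ A ++ B ∣ ≡ ∣ A ∣ + ∣ B ∣
∣++∣ []            B = refl
∣++∣ (inside  ∷ A) B = cong suc (∣++∣ A B)
∣++∣ (outside ∷ A) B = ∣++∣ A B

module _ (G : SimpleGraph m) (H : SimpleGraph n) where

  joinAdj : Fin m ⊎ Fin n → Fin m ⊎ Fin n → Bool
  joinAdj (inj₁ i) (inj₁ j) = adj G i j
  joinAdj (inj₂ i) (inj₂ j) = adj H i j
  joinAdj _        _        = true

  join : SimpleGraph (m + n)
  join .adj u v = joinAdj (splitAt m u) (splitAt m v)
  join .symm u v with splitAt m u | splitAt m v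
  ... | inj₁ i | inj₁ j = symm G i j
  ... | inj₁ _ | inj₂ _ = refl
  ... | inj₂ _ | inj₁ _ = refl
  ... | inj₂ i | inj₂ j = symm H i j
  join .loopless v with splitAt m v
  ... | inj₁ i = loopless G i
  ... | inj₂ j = loopless H j

  adj-ll : ∀ i j → adj join (i ↑ˡ n) (j ↑ˡ n) ≡ adj G i j
  adj-ll i j = cong₂ joinAdj (splitAt-↑ˡ m i n) (splitAt-↑ˡ m j n)

  adj-lr : ∀ i j → adj join (i ↑ˡ n) (m ↑ʳ j) ≡ true
  adj-lr i j = cong₂ joinAdj (splitAt-↑ˡ m i n) (splitAt-↑ʳ m n j)

  adj-rl : ∀ i j → adj join (m ↑ʳ i) (j ↑ˡ n) ≡ true
  adj-rl i j = cong₂ joinAdj (splitAt-↑ʳ m n i) (splitAt-↑ˡ m j n)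

  adj-rr : ∀ i j → adj join (m ↑ʳ i) (m ↑ʳ j) ≡ adj H i j
  adj-rr i j = cong₂ joinAdj (splitAt-↑ʳ m n i) (splitAt-↑ʳ m n j)

  ↑ˡ≢↑ʳ : ∀ i j → i ↑ˡ n ≢ m ↑ʳ j
  ↑ˡ≢↑ʳ i j eq with () ← trans (sym (splitAt-↑ˡ m i n)) (trans (cong (splitAt m) eq) (splitAt-↑ʳ m n j))

  universal-join : ∀ {h} → Universal H h → Universal join (m ↑ʳ h)
  universal-join {h} universal v v≢h with side m n v
  ... | left i  = adj-rl h i
  ... | right j = trans (adj-rr h j) (universal j λ j≡h → v≢h (cong (m ↑ʳ_) j≡h))

  module _ {A : Subset m} {B : Subset n} where

    -- Every vertex on the `H` side is adjacent to all of `A`, so a vertex on the `G` side that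
    -- agreed with it would be a common neighbour of `A`. Two vertices on one side are told apart by
    -- the set on that side.
    locating-join⁺ : Locating G A → NoCommonNeighbour G A → Locating H B → Locating join (A ++ B)
    locating-join⁺ locA noCommon locB u v u∉ v∉ same with side m n u | side m n v
    ... | left i  | left j  = cong (_↑ˡ n) (locA i j (λ p → u∉ (∈-++⁺ˡ p)) (λ p → v∉ (∈-++⁺ˡ p)) λ a a∈A →
      trans (sym (adj-ll i a)) (trans (same _ (∈-++⁺ˡ a∈A)) (adj-ll j a)))
    ... | right i | right j = cong (m ↑ʳ_) (locB i j (λ p → u∉ (∈-++⁺ʳ p)) (λ p → v∉ (∈-++⁺ʳ p)) λ b b∈B →
      trans (sym (adj-rr i b)) (trans (same _ (∈-++⁺ʳ b∈B)) (adj-rr j b)))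
    ... | left i  | right j = ⊥-elim (noCommon i λ a a∈A →
      trans (sym (adj-ll i a)) (trans (same _ (∈-++⁺ˡ a∈A)) (adj-rl j a)))
    ... | right i | left j  = ⊥-elim (noCommon j λ a a∈A →
      trans (sym (adj-ll j a)) (trans (sym (same _ (∈-++⁺ˡ a∈A))) (adj-rl i a)))

    module _ (loc : Locating join (A ++ B)) where

      -- All of `B` is adjacent to both `i` and `j`, so only `A` can tell them apart.
      locating-joinˡ : Locating G A
      locating-joinˡ i j i∉A j∉A same = ↑ˡ-injective n i j
        (loc _ _ (λ p → i∉A (∈-++⁻ˡ p)) (λ p → j∉A (∈-++⁻ˡ p)) same′)
        where
        same′ : ∀ w → w ∈ A ++ B → adj join (i ↑ˡ n) w ≡ adj join (j ↑ˡ n) w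
        same′ w w∈ with side m n w
        ... | left a  = trans (adj-ll i a) (trans (same a (∈-++⁻ˡ w∈)) (sym (adj-ll j a)))
        ... | right b = trans (adj-lr i b) (sym (adj-lr j b))

      locating-joinʳ : Locating H B
      locating-joinʳ i j i∉B j∉B same = ↑ʳ-injective m i j
        (loc _ _ (λ p → i∉B (∈-++⁻ʳ {A = A} p)) (λ p → j∉B (∈-++⁻ʳ {A = A} p)) same′)
        where
        same′ : ∀ w → w ∈ A ++ B → adj join (m ↑ʳ i) w ≡ adj join (m ↑ʳ j) w
        same′ w w∈ with side m n w
        ... | left a  = trans (adj-rl i a) (sym (adj-rl j a))
        ... | right b = trans (adj-rr i b) (trans (same b (∈-++⁻ʳ {A = A} w∈)) (sym (adj-rr j b)))

      -- In the join, `h` is adjacent to all of `A ++ B`. So is any common neighbour of `A`, and as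
      -- neither vertex lies in `A ++ B`, nothing would separate them.
      noCommonNeighbour-joinˡ : ∀ {h} → Universal H h → h ∉ B → NoCommonNeighbour G A
      noCommonNeighbour-joinˡ {h} universal h∉B v common = ↑ˡ≢↑ʳ v h
        (loc _ _ (λ p → v∉A (∈-++⁻ˡ p)) (λ p → h∉B (∈-++⁻ʳ {A = A} p)) same)
        where
        v∉A : v ∉ A
        -- A common neighbour inside `A` would be adjacent to itself.
        v∉A v∈A = adj⇒≢ G (common v v∈A) refl
        same : ∀ w → w ∈ A ++ B → adj join (v ↑ˡ n) w ≡ adj join (m ↑ʳ h) w
        same w w∈ with side m n w
        ... | left a  = trans (adj-ll v a) (trans (common a (∈-++⁻ˡ w∈)) (sym (adj-rl h a)))
        ... | right b = trans (adj-lr v b) (sym (trans (adj-rr h b) (universal b λ where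
          refl → h∉B (∈-++⁻ʳ {A = A} w∈))))

-- Small graphs

-- A search for a counterexample. Through `toWitness`, it reduces the claims about small graphs to
-- evaluation.
allSubset? : {P : Subset n → Set} → Decidable P → Dec (∀ W → P W)
allSubset? P? = map′ (λ ∄ W → decidable-stable (P? W) λ ¬p → ∄ (W , ¬p)) (λ ∀p (W , ¬p) → ¬p (∀p W))
  (¬? (anySubset? λ W → ¬? (P? W)))

locating? : (G : SimpleGraph n) → Decidable (Locating G)
locating? G W = all? λ u → all? λ v → ¬? (u ∈? W) →-dec ¬? (v ∈? W) →-dec
  (all? λ w → w ∈? W →-dec adj G u w Bool.≟ adj G v w) →-dec u ≟ v

noCommonNeighbour? : (G : SimpleGraph n) → Decidable (NoCommonNeighbour G)
noCommonNeighbour? G W = all? λ v → ¬? (all? λ w → w ∈? W →-dec adj G v w Bool.≟ true)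

universal? : (G : SimpleGraph n) → Decidable (Universal G)
universal? G h = all? λ v → ¬? (v ≟ h) →-dec adj G h v Bool.≟ true

_≟ₛ_ : (A B : Subset n) → Dec (A ≡ B)
_≟ₛ_ = ≡-dec Bool._≟_

module _ (es : List (ℕ × ℕ)) where

  listed : Fin n → Fin n → Bool
  listed u v = any (λ (i , j) → (toℕ u ≡ᵇ i) ∧ (toℕ v ≡ᵇ j)) es

  fromEdges : {irrefl : True (all? {n} λ v → listed v v Bool.≟ false)} → SimpleGraph n
  fromEdges .adj u v = listed u v ∨ listed v u
  fromEdges .symm u v = Bool.∨-comm (listed u v) (listed v u)
  fromEdges {irrefl = irrefl} .loopless v = cong₂ _∨_ (toWitness irrefl v) (toWitness irrefl v)

-- The triangle 2, 3, 4 with pendant vertices 0 at 3 and 1 at 2.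
bull : SimpleGraph 5
bull = fromEdges ((0 , 3) ∷ (1 , 2) ∷ (2 , 3) ∷ (2 , 4) ∷ (3 , 4) ∷ [])

horns : Subset 5
horns = inside ∷ inside ∷ outside ∷ outside ∷ outside ∷ []

horns-locating : Locating bull horns
horns-locating = toWitness {a? = locating? bull horns} _

horns-noCommonNeighbour : NoCommonNeighbour bull horns
horns-noCommonNeighbour = toWitness {a? = noCommonNeighbour? bull horns} _

-- With at most one vertex in `A`, at least four remain outside and share at most two neighbour
-- patterns.
bull-locating-size : ∀ A → Locating bull A → 2 ≤ ∣ A ∣
bull-locating-size = toWitness {a? = allSubset? λ A → locating? bull A →-dec 2 ≤? ∣ A ∣} _

-- Other pairs are locating too, such as 2 and 3, but each has a common neighbour, in this case 4.
horns-unique : ∀ A → ∣ A ∣ ≤ 2 → Locating bull A → NoCommonNeighbour bull A → A ≡ horns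
horns-unique = toWitness
  {a? = allSubset? λ A → ∣ A ∣ ≤? 2 →-dec locating? bull A →-dec noCommonNeighbour? bull A →-dec A ≟ₛ horns} _

-- The inductive invariant, its base cases and the join with the bull.

record UniquelyLocated (k n : ℕ) : Set where
  field
    graph     : SimpleGraph n
    hub       : Fin n
    universal : Universal graph hub
    basis     : Subset n
    size      : ∣ basis ∣ ≡ k
    -- In the next join, this rules out a common neighbour of the bull part.
    hub∉basis : hub ∉ basis
    locating  : Locating graph basis
    unique    : ∀ W → ∣ W ∣ ≤ k → Locating graph W → W ≡ basis

  -- `unique` also covers sets with fewer than `k` elements: a smaller locating set would be
  -- `basis`, which has `k`.
  minimal : ∀ W → Locating graph W → k ≤ ∣ W ∣
  minimal W loc with k ≤? ∣ W ∣
  ... | yes k≤ = k≤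
  ... | no  k≰ = ≤-reflexive (trans (sym size) (cong ∣_∣ (sym (unique W (<⇒≤ (≰⇒> k≰)) loc))))

open UniquelyLocated

singleVertex : UniquelyLocated 0 1
singleVertex .graph = fromEdges []
singleVertex .hub = zero
singleVertex .universal = toWitness {a? = universal? (fromEdges []) zero} _
-- The empty set, as one vertex leaves no pair to separate.
singleVertex .basis = outside ∷ []
singleVertex .size = refl
singleVertex .hub∉basis ()
singleVertex .locating zero zero _ _ _ = refl
singleVertex .unique = toWitness
  {a? = allSubset? λ W → ∣ W ∣ ≤? 0 →-dec locating? (fromEdges []) W →-dec W ≟ₛ (outside ∷ [])} _

-- Found by computer search.
nineVertices : SimpleGraph 9
nineVertices = join (singleVertex .graph) (fromEdges
  ((0 , 7) ∷ (1 , 5) ∷ (1 , 6) ∷ (2 , 4) ∷ (2 , 6) ∷ (4 , 7) ∷ (5 , 7) ∷ (6 , 7) ∷ []))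

-- Index 0 is the hub, so these are vertices 0, 1, 2 of the eight-vertex factor. In that numbering,
-- vertices 3 to 7 see none, 2, 1, both 1 and 2, and 0 respectively; the hub sees all three.
nineBasis : Subset 9
nineBasis = outside ∷ inside ∷ inside ∷ inside ∷ outside ∷ outside ∷ outside ∷ outside ∷ outside ∷ []

nineUniquelyLocated : UniquelyLocated 3 9
nineUniquelyLocated .graph = nineVertices
nineUniquelyLocated .hub = zero
nineUniquelyLocated .universal = toWitness {a? = universal? nineVertices zero} _
nineUniquelyLocated .basis = nineBasis
nineUniquelyLocated .size = refl
nineUniquelyLocated .hub∉basis ()
nineUniquelyLocated .locating = toWitness {a? = locating? nineVertices nineBasis} _
nineUniquelyLocated .unique = toWitness
  {a? = allSubset? λ W → ∣ W ∣ ≤? 3 →-dec locating? nineVertices W →-dec W ≟ₛ nineBasis} _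

joinBull : UniquelyLocated k n → UniquelyLocated (2 + k) (5 + n)
joinBull U .graph = join bull (U .graph)
joinBull U .hub = 5 ↑ʳ U .hub
joinBull U .universal = universal-join bull (U .graph) (U .universal)
joinBull U .basis = horns ++ U .basis
joinBull U .size = cong (2 +_) (U .size)
joinBull U .hub∉basis p = U .hub∉basis (∈-++⁻ʳ {A = horns} p)
joinBull U .locating = locating-join⁺ bull (U .graph) horns-locating horns-noCommonNeighbour (U .locating)
joinBull {k} U .unique W ∣W∣≤ loc with Vec.splitAt 5 W
... | A , B , refl = cong₂ _++_ A≡horns B≡basis
  where
  ∣A∣+∣B∣≤ : ∣ A ∣ + ∣ B ∣ ≤ 2 + k
  ∣A∣+∣B∣≤ = subst (_≤ 2 + k) (∣++∣ A B) ∣W∣≤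
  locA : Locating bull A
  locA = locating-joinˡ bull (U .graph) loc
  locB : Locating (U .graph) B
  locB = locating-joinʳ bull (U .graph) {A = A} loc
  ∣B∣≤k : ∣ B ∣ ≤ k
  -- The bull part takes at least 2 of the `2 + k` elements.
  ∣B∣≤k = +-cancelˡ-≤ 2 _ _ (≤-trans (+-monoˡ-≤ ∣ B ∣ (bull-locating-size A locA)) ∣A∣+∣B∣≤)
  B≡basis : B ≡ U .basis
  B≡basis = U .unique B ∣B∣≤k locB
  ∣A∣≤2 : ∣ A ∣ ≤ 2
  -- Now that `B` is known to be the basis, it takes exactly `k`.
  ∣A∣≤2 = +-cancelʳ-≤ k _ _ (subst (λ b → ∣ A ∣ + b ≤ 2 + k) (trans (cong ∣_∣ B≡basis) (U .size)) ∣A∣+∣B∣≤)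
  A≡horns : A ≡ horns
  A≡horns = horns-unique A ∣A∣≤2 locA
    (noCommonNeighbour-joinˡ bull (U .graph) loc (U .universal) (subst (U .hub ∉_) (sym B≡basis) (U .hub∉basis)))

uniquelyLocated : ∀ k → UniquelyLocated (2 + k) (⌈ 5 * (2 + k) /2⌉ + 1)
uniquelyLocated 0 = joinBull singleVertex
uniquelyLocated 1 = nineUniquelyLocated
-- Once `5 * (4 + k)` is written as `5 * 2 + 5 * (2 + k)`, the halving strips the ten successors and
-- yields the 5 new vertices by computation.
uniquelyLocated (suc (suc k)) = subst (λ x → UniquelyLocated (4 + k) (⌈ x /2⌉ + 1))
  (sym (*-distribˡ-+ 5 2 (2 + k))) (joinBull (uniquelyLocated k))

-- From locating sets back to metric bases.

module _ (U : UniquelyLocated k n) where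

  metricBasis : MetricBasis (U .graph) (U .basis)
  metricBasis = locating⇒resolving (U .graph) (U .locating) , λ W res →
    subst (_≤ ∣ W ∣) (sym (U .size)) (minimal U W (resolving⇒locating (U .graph) (U .universal) res))

  metricBasis-unique : ∀ W → MetricBasis (U .graph) W → W ≡ U .basis
  metricBasis-unique W (res , min) = U .unique W
    -- Minimality of `W` is applied to the resolving set `U .basis`, which bounds `∣ W ∣` by `k`.
    (subst (∣ W ∣ ≤_) (U .size) (min (U .basis) (proj₁ metricBasis)))
    (resolving⇒locating (U .graph) (U .universal) res)

theorem8 : (k : ℕ) → 2 ≤ k →
    Σ (SimpleGraph (⌈ 5 * k /2⌉ + 1)) λ G →
    Connected G × MetricDimension G k × UniqueMetricBasis G
theorem8 (suc (suc k)) (s≤s (s≤s z≤n)) =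
  U .graph , universal⇒connected (U .graph) (U .universal) ,
  (U .basis , metricBasis U , U .size) ,
  (U .basis , metricBasis U , metricBasis-unique U)
  where
  U : UniquelyLocated (2 + k) (⌈ 5 * (2 + k) /2⌉ + 1)
  U = uniquelyLocated k
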